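{- For every Boolean function $f:\{0,1\}^n\to\{0,1\}$, $n\ge1$, the following are equivalent: 1. $f\in\mathrm{ST}$; 2. $f\in\mathrm{Pol}(\mathbb{ST}_L,\mathbb{ST}_R)\cap\mathrm{Pol}(\{0\})\cap\mathrm{Pol}(\{1\})$; 3. $f$ is idempotent and every non-unary minor of $f$ has a fixing pair (note that $f$ is its own minor as well).
   Context: For a real tuple $\overline a=(a_1,\dots,a_n)$ and a real $t$, $\langle\overline a|^t_{\le}:\{0,1\}^n\to\{0,1\}$ has value $0$ at $\overline x$ if $\sum_i a_ix_i\le t$ and value $1$ otherwise. A function $g:A^m\to B$ is a minor of $f:A^n\to B$ if for some $\pi:[n]\to[m]$, $g(a_1,\dots,a_m)=f(a_{\pi(1)},\dots,a_{\pi(n)})$ for all $a_1,\dots,a_m\in A$; non-unary means arity at least $2$. A minion is a set of functions closed under minors; the minion generated by a set is the smallest minion containing it. $\mathrm{ST}$ is the minion generated by the functions $\langle 1,2,-2,4,-4,\dots,2^m,-2^m|^{0}_{\le}$ of arity $2m+1$, for all $m\ge0$. $\mathrm{Pol}(\mathbb{A},\mathbb{B})$, for similar relational structures, is the set of all homomorphisms $\mathbb{A}^n\to\mathbb{B}$, $n\ge1$ ($\mathbb{A}^n$ having coordinatewise relations). $\mathrm{Pol}(\{c\})$, $c\in\{0,1\}$, is the set of Boolean functions preserving the unary relation $\{c\}$, i.e. with $f(c,\dots,c)=c$. $\mathbb{ST}_L$ and $\mathbb{ST}_R$ are relational structures on $\{0,1\}$, $\mathbb{ST}_L=(\{0,1\};R,2\mathrm{in}4)$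 and $\mathbb{ST}_R=(\{0,1\};\mathrm{NAE}_6,\mathrm{NAE}_4)$, where $R$ is the $6$-ary relation $$R=\{(1,0,1,0,1,0),(0,1,0,1,0,1),(1,1,0,0,0,0),(0,0,1,1,0,0),(0,0,0,0,1,1)\},$$ $2\mathrm{in}4$ is the set of all $4$-tuples in $\{0,1\}^4$ with exactly two entries equal to $1$, and $\mathrm{NAE}_k$ is the set of all non-constant $k$-tuples in $\{0,1\}^k$. $f$ is idempotent if $f(a,\dots,a)=a$ for $a\in\{0,1\}$. A pair $(i,j)$ of distinct coordinates is a fixing pair of a Boolean function $f$ if $f(\overline a)=0$ whenever $a_i=0$ and $a_j=1$, and $f(\overline a)=1$ whenever $a_i=1$ and $a_j=0$. -}

module Defs where

open import Data.Bool using (Bool; true; false; not)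
import Data.Bool.Properties as Bool
open import Data.Fin using (Fin; toℕ)
open import Data.Integer as ℤ using (ℤ; +_; 0ℤ; 1ℤ)
open import Data.List using (List; []; _∷_)
open import Data.List.Membership.Propositional using (_∈_)
open import Data.Nat using (ℕ; suc; _*_; _^_; _≤_)
open import Data.Product using (_×_; ∃-syntax; Σ-syntax)
open import Data.Vec using (Vec; []; _∷_; map; lookup; tabulate; replicate; concat; zipWith; foldr; count)
open import Level as Level using (Level; 0ℓ)
open import Relation.Binary.PropositionalEquality using (_≡_; _≢_)
open import Relation.Nullary using (¬_; does)
open import Relation.Unary using (Pred; _⊆_)

private
  variable
    ℓ : Level
    A B : Set
    m n : ℕ

-- The domain {0,1} is Bool.
pattern 𝟎 = false
pattern 𝟏 = true

------------------------------------------------------------------------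
-- Functions of several variables, minors, minions

-- Functions are compared pointwise throughout; in particular a minion is
-- automatically closed under pointwise equality (take π to be the identity).
Op : Set → Set → ℕ → Set
Op A B n = Vec A n → B

BoolFun : ℕ → Set
BoolFun = Op Bool Bool

_MinorOf_ : Op A B m → Op A B n → Set
_MinorOf_ {m = m} {n = n} g f =
  Σ[ π ∈ (Fin n → Fin m) ] (∀ a → g a ≡ f (tabulate (λ i → lookup a (π i))))

FunSet : Set → Set → (ℓ : Level) → Set (Level.suc ℓ)
FunSet A B ℓ = (n : ℕ) → Pred (Op A B n) ℓ

IsMinion : FunSet A B ℓ → Set ℓ
IsMinion {A = A} {B = B} M =
  ∀ {m n} {g : Op A B m} {f : Op A B n} → g MinorOf f → M n f → M m g

-- Nullary functions are not excluded by the type, but a set of functions of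
-- positive arity generates only functions of positive arity, because a minor
-- of f : Aⁿ → B of arity m requires a map [n] → [m].
data Generated (S : FunSet A B 0ℓ) : FunSet A B 0ℓ where
  base  : {f : Op A B n} → S n f → Generated S n f
  minor : {g : Op A B m} {f : Op A B n} →
          g MinorOf f → Generated S n f → Generated S m g

generated-isMinion : (S : FunSet A B 0ℓ) → IsMinion (Generated S)
generated-isMinion S = minor

generated-least : (S : FunSet A B 0ℓ) (M : FunSet A B ℓ) → IsMinion M →
                  (∀ n → S n ⊆ M n) → ∀ n → Generated S n ⊆ M n
generated-least S M isM S⊆M n (base s)    = S⊆M n s
generated-least S M isM S⊆M n (minor p q) =
  isM p (generated-least S M isM S⊆M _ q)

------------------------------------------------------------------------
-- Threshold functions and ST

bit : Bool → ℤ
bit 𝟎 = 0ℤ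
bit 𝟏 = 1ℤ

weightedSum : Vec ℤ n → Vec Bool n → ℤ
weightedSum a x = foldr _ ℤ._+_ 0ℤ (zipWith (λ aᵢ xᵢ → aᵢ ℤ.* bit xᵢ) a x)

-- Integer weights and thresholds suffice for ST.
⟨_∣≤_ : Vec ℤ n → ℤ → BoolFun n
(⟨ a ∣≤ t) x = not (does (weightedSum a x ℤ.≤? t))

-- (1, 2, -2, 4, -4, …, 2ᵐ, -2ᵐ)
stWeights : (m : ℕ) → Vec ℤ (suc (m * 2))
stWeights m = 1ℤ ∷ concat (tabulate {n = m} λ i →
  + (2 ^ suc (toℕ i)) ∷ ℤ.- (+ (2 ^ suc (toℕ i))) ∷ [])

data STGenerator : FunSet Bool Bool 0ℓ where
  stGenerator : (m : ℕ) → STGenerator (suc (m * 2)) (⟨ stWeights m ∣≤ 0ℤ)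

ST : FunSet Bool Bool 0ℓ
ST = Generated STGenerator

------------------------------------------------------------------------
-- Relational structures and polymorphisms

record Signature : Set₁ where
  field
    Symbol : Set
    arity  : Symbol → ℕ

open Signature public

record Structure (σ : Signature) : Set₁ where
  field
    Carrier : Set
    rel     : (s : Symbol σ) → Pred (Vec Carrier (arity σ s)) 0ℓ

open Structure public

private
  variable
    σ : Signature

IsHomomorphism : (𝔸 𝔹 : Structure σ) → Pred (Carrier 𝔸 → Carrier 𝔹) 0ℓ
IsHomomorphism 𝔸 𝔹 h = ∀ s t → rel 𝔸 s t → rel 𝔹 s (map h t)

power : Structure σ → ℕ → Structure σ
power 𝔸 n = record
  { Carrier = Vec (Carrier 𝔸) n
  ; rel     = λ s t → ∀ (i : Fin n) → rel 𝔸 s (map (λ v → lookup v i) t)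
  }

Pol : (𝔸 𝔹 : Structure σ) → FunSet (Carrier 𝔸) (Carrier 𝔹) 0ℓ
Pol 𝔸 𝔹 n = IsHomomorphism (power 𝔸 n) 𝔹

data UnarySymbol : Set where
  unary : UnarySymbol

unarySignature : Signature
unarySignature = record { Symbol = UnarySymbol ; arity = λ _ → 1 }

-- ({0,1}; {c})
constStructure : Bool → Structure unarySignature
constStructure c = record { Carrier = Bool ; rel = λ _ t → t ≡ c ∷ [] }

PolConst : Bool → FunSet Bool Bool 0ℓ
PolConst c = Pol (constStructure c) (constStructure c)

------------------------------------------------------------------------
-- The structures ST_L and ST_R

R : Pred (Vec Bool 6) 0ℓ
R t = t ∈ (𝟏 ∷ 𝟎 ∷ 𝟏 ∷ 𝟎 ∷ 𝟏 ∷ 𝟎 ∷ [])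
        ∷ (𝟎 ∷ 𝟏 ∷ 𝟎 ∷ 𝟏 ∷ 𝟎 ∷ 𝟏 ∷ [])
        ∷ (𝟏 ∷ 𝟏 ∷ 𝟎 ∷ 𝟎 ∷ 𝟎 ∷ 𝟎 ∷ [])
        ∷ (𝟎 ∷ 𝟎 ∷ 𝟏 ∷ 𝟏 ∷ 𝟎 ∷ 𝟎 ∷ [])
        ∷ (𝟎 ∷ 𝟎 ∷ 𝟎 ∷ 𝟎 ∷ 𝟏 ∷ 𝟏 ∷ [])
        ∷ []

2in4 : Pred (Vec Bool 4) 0ℓ
2in4 t = count (Bool._≟ 𝟏) t ≡ 2

NAE : (k : ℕ) → Pred (Vec Bool k) 0ℓ
NAE k t = ¬ (∃[ c ] t ≡ replicate k c)

data STSymbol : Set where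
  six four : STSymbol

stSignature : Signature
stSignature = record
  { Symbol = STSymbol
  ; arity  = λ { six → 6 ; four → 4 }
  }

STL : Structure stSignature
STL = record { Carrier = Bool ; rel = λ { six → R ; four → 2in4 } }

STR : Structure stSignature
STR = record { Carrier = Bool ; rel = λ { six → NAE 6 ; four → NAE 4 } }

------------------------------------------------------------------------
-- Idempotence and fixing pairs

Idempotent : BoolFun n → Set
Idempotent {n} f = ∀ a → f (replicate n a) ≡ a

FixingPair : BoolFun n → Fin n → Fin n → Set
FixingPair f i j =
  i ≢ j ×
  (∀ a → lookup a i ≡ 𝟎 → lookup a j ≡ 𝟏 → f a ≡ 𝟎) ×
  (∀ a → lookup a i ≡ 𝟏 → lookup a j ≡ 𝟎 → f a ≡ 𝟏)

HasFixingPair : BoolFun n → Set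
HasFixingPair f = ∃[ i ] ∃[ j ] FixingPair f i j

NonUnaryMinorsHaveFixingPair : BoolFun n → Set
NonUnaryMinorsHaveFixingPair f =
  ∀ {m} → 2 ≤ m → (g : BoolFun m) → g MinorOf f → HasFixingPair g

{-# OPTIONS --safe #-}

-- A generator of ST returns the value at the first coordinate of the heaviest
-- pair whose two coordinates differ, so peeling off fixing pairs one at a time
-- turns (3) into (1).  It is a polymorphism since any two distinct tuples of a
-- relation of ST_L are incomparable and no tuple is constant: the heaviest pair
-- of differing columns yields both values.
--
-- For (2) ⇒ (3), identify f with a family of sets, and let P be the set of
-- elements whose singletons belong to it and N the set of the others.  The
-- relation R makes the family and its complement closed under disjoint unions,
-- so the family is stable under adding elements of P and removing elements of N,
-- and (p , q) is fixing iff {p} ∪ N∖{q} belongs to it.  Suppose no pair is fixing.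
-- By induction on the arity, identifying x and y in N gives p with
-- {p} ∪ N∖{x , y} in the family; by 2in4 one p serves all x, y.  If P and N have
-- at least three elements, this contradicts the dual statement with P and N
-- exchanged.  If P = {p , l} and x , y , z ∈ N, then R is violated by the
-- partition of the coordinates into {l}, {x}, {y}, {z} and the rest.  The
-- remaining cases follow from self-duality.
module Submission where

open import Data.Bool using (Bool; true; false; not; _∧_; _∨_; if_then_else_)
open import Data.Bool.Properties using (not-injective; not-involutive) renaming (_≟_ to _≟ᵇ_)
open import Data.Empty using (⊥; ⊥-elim)
open import Data.Fin using (Fin; zero; suc; toℕ; punchIn; punchOut; _≟_)
open import Data.Fin.Properties using (any?; punchIn-punchOut; punchInᵢ≢i; punchIn-injective)
open import Data.Integer as ℤ using (ℤ; +_; -[1+_]; 0ℤ; 1ℤ; -≤-; -≤+; +≤+)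
import Data.Integer.Properties as ℤ
open import Data.Integer.Tactic.RingSolver using (solve-∀)
open import Data.List using (List; []; _∷_; allFin)
import Data.List.Membership.DecPropositional as DecMembership
import Data.List.Membership.Propositional as List
open import Data.List.Membership.Propositional.Properties using (∈-allFin)
open import Data.List.Relation.Unary.Any using (here; there)
open import Data.Maybe using (Maybe; just; nothing; fromMaybe; _<∣>_)
open import Data.Maybe.Properties using (<∣>-assoc; <∣>-identityʳ)
open import Data.Nat using (ℕ; zero; suc; _*_; _^_; _≤_; z≤n; s≤s)
open import Data.Nat.Properties using (≤-refl) renaming (_≟_ to _≟ⁿ_)
open import Data.Product using (_×_; _,_; ∃-syntax; proj₁; proj₂)
open import Data.Sum using (_⊎_; inj₁; inj₂; swap)
open import Data.Vec using (Vec; []; _∷_; lookup; count; map; tabulate; concat; replicate)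
open import Data.Vec.Properties
  using (≡-dec; ∷-injectiveˡ; lookup∘tabulate; tabulate∘lookup; tabulate-cong; tabulate-∘;
         lookup-map; lookup-replicate; map-∘; map-cong)
open import Function using (_∘_; id)
open import Function.Bundles using (_⇔_; mk⇔)
open import Relation.Binary.PropositionalEquality
open import Relation.Nullary using (Dec; ¬_; does; yes; no; contradiction)
open import Relation.Nullary.Decidable
  using (_×-dec_; _⊎-dec_; _→-dec_; ¬?; map′; dec-true; dec-false; decidable-stable; from-yes)
open import Relation.Unary using (_∈_; _∩_)
open import Defs
open DecMembership (≡-dec {n = 6} _≟ᵇ_) using (_∈?_)

private
  variable
    n : ℕ

-- Set families and the conditions imposed by the two relations

Family : ℕ → Set
Family n = (Fin n → Bool) → Bool

-- A map from the coordinates to Column is a partition into five parts, and the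
-- rows of the resulting matrix are the sets X ∪ Cᵢ and Y ∪ Cᵢ.
data Column : Set where
  X Y C₁ C₂ C₃ : Column

column : Column → Vec Bool 6
column X  = 𝟏 ∷ 𝟎 ∷ 𝟏 ∷ 𝟎 ∷ 𝟏 ∷ 𝟎 ∷ []
column Y  = 𝟎 ∷ 𝟏 ∷ 𝟎 ∷ 𝟏 ∷ 𝟎 ∷ 𝟏 ∷ []
column C₁ = 𝟏 ∷ 𝟏 ∷ 𝟎 ∷ 𝟎 ∷ 𝟎 ∷ 𝟎 ∷ []
column C₂ = 𝟎 ∷ 𝟎 ∷ 𝟏 ∷ 𝟏 ∷ 𝟎 ∷ 𝟎 ∷ []
column C₃ = 𝟎 ∷ 𝟎 ∷ 𝟎 ∷ 𝟎 ∷ 𝟏 ∷ 𝟏 ∷ []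

-- The polymorphism condition read on sets: the tuple at each coordinate lies in the relation, and
-- the rows are not all mapped to one value. `ext` stands in for function extensionality, since sets
-- are functions here.
record Compatible (F : Family n) : Set where
  field
    ext      : ∀ {a b} → (∀ i → a i ≡ b i) → F a ≡ F b
    six-nae  : ∀ (c : Fin n → Column) v → ¬ (∀ r → F (λ i → lookup (column (c i)) r) ≡ v)
    four-nae : ∀ {a b c d} → (∀ i → 2in4 (a i ∷ b i ∷ c i ∷ d i ∷ [])) →
           ∀ {v} → F a ≡ v → F b ≡ v → F c ≡ v → F d ≡ v → ⊥

Fixes : Family n → Fin n → Fin n → Set
Fixes F i j =
  i ≢ j ×
  (∀ a → a i ≡ 𝟎 → a j ≡ 𝟏 → F a ≡ 𝟎) ×
  (∀ a → a i ≡ 𝟏 → a j ≡ 𝟎 → F a ≡ 𝟏)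

-- A fixing pair of the minor that identifies `y` with `x`, expressed in the coordinates of `F`. The
-- coordinate `y` is the one that disappears, so neither `i` nor `j` may equal it.
FixesWhenMerged : Family n → (x y i j : Fin n) → Set
FixesWhenMerged F x y i j =
  i ≢ j × i ≢ y × j ≢ y ×
  (∀ a → a x ≡ a y → a i ≡ 𝟎 → a j ≡ 𝟏 → F a ≡ 𝟎) ×
  (∀ a → a x ≡ a y → a i ≡ 𝟏 → a j ≡ 𝟎 → F a ≡ 𝟏)

single : Fin n → Fin n → Bool
single i j = does (i ≟ j)

single-refl : (i : Fin n) → single i i ≡ 𝟏
single-refl i = dec-true (i ≟ i) refl

single-≢ : {i j : Fin n} → i ≢ j → single i j ≡ 𝟎
single-≢ {i = i} {j} i≢j = dec-false (i ≟ j) i≢j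

single-≡ : (i j : Fin n) → single i j ≡ 𝟏 → i ≡ j
single-≡ i j e with i ≟ j
... | yes p = p

≢𝟏⇒≡𝟎 : ∀ {b} → b ≢ 𝟏 → b ≡ 𝟎
≢𝟏⇒≡𝟎 {𝟎} _ = refl
≢𝟏⇒≡𝟎 {𝟏} h = contradiction refl h

≢𝟎⇒≡𝟏 : ∀ {b} → b ≢ 𝟎 → b ≡ 𝟏
≢𝟎⇒≡𝟏 {𝟏} _ = refl
≢𝟎⇒≡𝟏 {𝟎} h = contradiction refl h

𝟏≢𝟎 : ∀ {b} → b ≡ 𝟏 → b ≢ 𝟎
𝟏≢𝟎 refl ()

≢⇒≡not : ∀ {b v} → b ≢ v → b ≡ not v
≢⇒≡not {v = 𝟎} = ≢𝟎⇒≡𝟏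
≢⇒≡not {v = 𝟏} = ≢𝟏⇒≡𝟎

-- Passing to the complement of the family exchanges P and N.
compatible-not : {F : Family n} → Compatible F → Compatible (not ∘ F)
compatible-not F-compatible = record
  { ext      = λ h → cong not (ext h)
  ; six-nae  = λ c v h → six-nae c (not v) (λ r → unnot (h r))
  ; four-nae = λ h a b c d → four-nae h (unnot a) (unnot b) (unnot c) (unnot d)
  }
  where
  open Compatible F-compatible
  unnot : ∀ {b v} → not b ≡ v → b ≡ not v
  unnot {b} refl = sym (not-involutive b)

fixes-not : {F : Family n} {i j : Fin n} → Fixes (not ∘ F) i j → Fixes F j i
fixes-not (i≢j , to𝟎 , to𝟏) =
  i≢j ∘ sym , (λ a p q → not-injective (to𝟏 a q p)) , (λ a p q → not-injective (to𝟎 a q p))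

fixesWhenMerged-not : {F : Family n} {x y i j : Fin n} →
  FixesWhenMerged F x y i j → FixesWhenMerged (not ∘ F) x y j i
fixesWhenMerged-not (i≢j , i≢y , j≢y , to𝟎 , to𝟏) =
  i≢j ∘ sym , j≢y , i≢y ,
  (λ a e p q → cong not (to𝟏 a e q p)) , (λ a e p q → cong not (to𝟎 a e q p))

-- Disjoint unions and stability under adding P and removing N

module _ {F : Family n} (F-compatible : Compatible F) where
  open Compatible F-compatible

  -- The rows `a`, `a`, `not ∘ a`, `not ∘ a` have exactly two ones in every column, so 2in4 forbids
  -- equal values.
  complement : ∀ a {v} → F a ≡ v → F (not ∘ a) ≡ not v
  complement a {v} e = ≢⇒≡not λ e′ → four-nae {a} {a} {not ∘ a} {not ∘ a} two e e e′ e′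
    where
    two : ∀ i → 2in4 (a i ∷ a i ∷ not (a i) ∷ not (a i) ∷ [])
    two i with a i
    ... | 𝟎 = refl
    ... | 𝟏 = refl

  -- If the union had the other value, its complement would have value `v`. Then `a`, `b` and that
  -- complement, taken as `C₁`, `C₂`, `C₃` with `X` and `Y` empty, give six rows of value `v`.
  union : ∀ a b {v} → (∀ i → a i ≡ 𝟏 → b i ≡ 𝟎) →
          F a ≡ v → F b ≡ v → F (λ i → a i ∨ b i) ≡ v
  union a b {v} disjoint ea eb with F (λ i → a i ∨ b i) ≟ᵇ v
  ... | yes e = e
  ... | no ¬e = ⊥-elim (six-nae c v rows)
    where
    rest : F (λ i → not (a i ∨ b i)) ≡ v
    rest = trans (complement (λ i → a i ∨ b i) (≢⇒≡not ¬e)) (not-involutive v)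
    part : Bool → Bool → Column
    part 𝟏 _ = C₁
    part 𝟎 𝟏 = C₂
    part 𝟎 𝟎 = C₃
    c : Fin n → Column
    c i = part (a i) (b i)
    columns : ∀ i → column (c i) ≡
      a i ∷ a i ∷ b i ∷ b i ∷ not (a i ∨ b i) ∷ not (a i ∨ b i) ∷ []
    columns i with a i | b i | disjoint i
    ... | 𝟏 | 𝟎 | _ = refl
    ... | 𝟏 | 𝟏 | h = contradiction (h refl) λ ()
    ... | 𝟎 | 𝟏 | _ = refl
    ... | 𝟎 | 𝟎 | _ = refl
    row : ∀ r → F (λ i → lookup (column (c i)) r) ≡
          F (λ i → lookup (a i ∷ a i ∷ b i ∷ b i ∷ not (a i ∨ b i) ∷ not (a i ∨ b i) ∷ []) r)
    row r = ext λ i → cong (λ t → lookup t r) (columns i)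
    rows : ∀ r → F (λ i → lookup (column (c i)) r) ≡ v
    rows r@zero                               = trans (row r) ea
    rows r@(suc zero)                         = trans (row r) ea
    rows r@(suc (suc zero))                   = trans (row r) eb
    rows r@(suc (suc (suc zero)))             = trans (row r) eb
    rows r@(suc (suc (suc (suc zero))))       = trans (row r) rest
    rows r@(suc (suc (suc (suc (suc zero))))) = trans (row r) rest

  pos : Fin n → Bool
  pos i = F (single i)

  private
    assign : (Fin n → Bool) → Fin n → Bool → Fin n → Bool
    assign a i v k = if single i k then v else a k

    assign-same : ∀ a i v → assign a i v i ≡ v
    assign-same a i v rewrite single-refl i = refl

    assign-other : ∀ a {i k} v → i ≢ k → assign a i v k ≡ a k
    assign-other a v i≢k rewrite single-≢ i≢k = refl

    assign-id : ∀ a i v → a i ≡ v → ∀ k → assign a i v k ≡ a k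
    assign-id a i v e k with i ≟ k
    ... | yes refl = sym e
    ... | no _     = refl

    assign-step : ∀ a i v → (a i ≡ 𝟏 → v ≡ 𝟎 → pos i ≡ 𝟎) → (a i ≡ 𝟎 → v ≡ 𝟏 → pos i ≡ 𝟏) →
                  F a ≡ 𝟏 → F (assign a i v) ≡ 𝟏
    assign-step a i v lose gain e with a i in ai | v
    ... | 𝟏 | 𝟏 = trans (ext (assign-id a i 𝟏 ai)) e
    ... | 𝟎 | 𝟎 = trans (ext (assign-id a i 𝟎 ai)) e
    ... | 𝟎 | 𝟏 = trans (ext pointwise) (union a (single i) disjoint e (gain refl refl))
      where
      disjoint : ∀ k → a k ≡ 𝟏 → single i k ≡ 𝟎
      disjoint k ak = single-≢ {i = i} {k} λ { refl → 𝟏≢𝟎 ak ai }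
      pointwise : ∀ k → assign a i 𝟏 k ≡ a k ∨ single i k
      pointwise k with i ≟ k | a k
      ... | yes _ | 𝟎 = refl
      ... | yes _ | 𝟏 = refl
      ... | no _  | 𝟎 = refl
      ... | no _  | 𝟏 = refl
    -- If `a` without `i` were outside the family, so would be its disjoint union with the singleton
    -- of `i`, which is `a`.
    ... | 𝟏 | 𝟎 = ≢𝟎⇒≡𝟏 λ e′ → 𝟏≢𝟎 e
      (trans (ext pointwise) (union (assign a i 𝟎) (single i) disjoint e′ (lose refl refl)))
      where
      disjoint : ∀ k → assign a i 𝟎 k ≡ 𝟏 → single i k ≡ 𝟎
      disjoint k ak = single-≢ {i = i} {k} λ { refl → 𝟏≢𝟎 ak (assign-same a i 𝟎) }
      pointwise : ∀ k → a k ≡ assign a i 𝟎 k ∨ single i k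
      pointwise k with i ≟ k
      ... | yes refl = ai
      ... | no _ with a k
      ...   | 𝟎 = refl
      ...   | 𝟏 = refl

  -- Turns `a` into `b` one coordinate at a time. The list in `go` always contains every coordinate
  -- at which the current set still differs from `b`.
  monotone : ∀ a b → (∀ i → a i ≡ 𝟏 → b i ≡ 𝟎 → pos i ≡ 𝟎) → (∀ i → a i ≡ 𝟎 → b i ≡ 𝟏 → pos i ≡ 𝟏) →
             F a ≡ 𝟏 → F b ≡ 𝟏
  monotone a b = go (allFin n) a (λ i → inj₂ (∈-allFin i))
    where
    go : ∀ is a → (∀ i → a i ≡ b i ⊎ i List.∈ is) →
         (∀ i → a i ≡ 𝟏 → b i ≡ 𝟎 → pos i ≡ 𝟎) → (∀ i → a i ≡ 𝟎 → b i ≡ 𝟏 → pos i ≡ 𝟏) →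
         F a ≡ 𝟏 → F b ≡ 𝟏
    go [] a differ lose gain e = trans (sym (ext same)) e
      where
      same : ∀ i → a i ≡ b i
      same i with differ i
      ... | inj₁ p = p
    go (j ∷ is) a differ lose gain e =
      go is a′ differ′ lose′ gain′ (assign-step a j (b j) (lose j) (gain j) e)
      where
      a′ : Fin n → Bool
      a′ = assign a j (b j)
      a′≡ : ∀ i → a′ i ≡ b i ⊎ (j ≢ i × a′ i ≡ a i)
      a′≡ i with i ≟ j
      ... | yes refl = inj₁ (assign-same a i (b i))
      ... | no i≢j   = inj₂ (i≢j ∘ sym , assign-other a (b j) (i≢j ∘ sym))
      differ′ : ∀ i → a′ i ≡ b i ⊎ i List.∈ is
      differ′ i with a′≡ i | differ i
      ... | inj₁ p         | _                 = inj₁ p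
      ... | inj₂ (_ , q)   | inj₁ p            = inj₁ (trans q p)
      ... | inj₂ (j≢i , _) | inj₂ (here i≡j)   = contradiction (sym i≡j) j≢i
      ... | inj₂ _         | inj₂ (there i∈is) = inj₂ i∈is
      lose′ : ∀ i → a′ i ≡ 𝟏 → b i ≡ 𝟎 → pos i ≡ 𝟎
      lose′ i p q with a′≡ i
      ... | inj₁ r       = contradiction q (𝟏≢𝟎 (trans (sym r) p))
      ... | inj₂ (_ , r) = lose i (trans (sym r) p) q
      gain′ : ∀ i → a′ i ≡ 𝟎 → b i ≡ 𝟏 → pos i ≡ 𝟏
      gain′ i p q with a′≡ i
      ... | inj₁ r       = contradiction (trans (sym r) p) (𝟏≢𝟎 q)
      ... | inj₂ (_ , r) = gain i (trans (sym r) p) q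

  -- With P empty, the complement of a singleton is in the family, and removing elements of N
  -- shrinks it to another singleton, which would then be positive.
  exists-pos : (∀ i → ∃[ j ] i ≢ j) → Fin n → ∃[ p ] pos p ≡ 𝟏
  exists-pos other i with any? (λ p → pos p ≟ᵇ 𝟏)
  ... | yes found = found
  ... | no none = ⊥-elim (none (j , monotone (not ∘ single i) (single j)
      (λ k _ _ → ≢𝟏⇒≡𝟎 λ e → none (k , e)) gain (complement (single i) i-neg)))
    where
    j = proj₁ (other i)
    i-neg : pos i ≡ 𝟎
    i-neg = ≢𝟏⇒≡𝟎 λ e → none (i , e)
    gain : ∀ k → not (single i k) ≡ 𝟎 → single j k ≡ 𝟏 → pos k ≡ 𝟏
    gain k p q = contradiction
      (trans (single-≡ i k (not-injective p)) (sym (single-≡ j k q)))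
      (proj₂ (other i))

  -- Cuts and their comparison

  -- {p} ∪ N ∖ {x , y}, where N is the set of elements that are not positive
  cut : (p x y : Fin n) → Fin n → Bool
  cut p x y i = single p i ∨ (not (pos i) ∧ (not (single x i) ∧ not (single y i)))

  ∈-cut⁻ : ∀ p x y i → cut p x y i ≡ 𝟏 → p ≡ i ⊎ (pos i ≡ 𝟎 × x ≢ i × y ≢ i)
  ∈-cut⁻ p x y i e with p ≟ i | pos i | x ≟ i | y ≟ i
  ... | yes p≡i | _ | _      | _      = inj₁ p≡i
  ... | no _    | 𝟎 | no x≢i | no y≢i = inj₂ (refl , x≢i , y≢i)

  ∈-cut : ∀ p x y i → p ≡ i ⊎ (pos i ≡ 𝟎 × x ≢ i × y ≢ i) → cut p x y i ≡ 𝟏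
  ∈-cut p x y _ (inj₁ refl) rewrite single-refl p = refl
  ∈-cut p x y i (inj₂ (i-neg , x≢i , y≢i))
    rewrite i-neg | single-≢ x≢i | single-≢ y≢i with single p i
  ... | 𝟎 = refl
  ... | 𝟏 = refl

  ∉-cut : ∀ p x y i → p ≢ i → x ≡ i ⊎ y ≡ i → cut p x y i ≡ 𝟎
  ∉-cut p x y i p≢i x∨y = ≢𝟏⇒≡𝟎 λ e → clash (∈-cut⁻ p x y i e) x∨y
    where
    clash : p ≡ i ⊎ (pos i ≡ 𝟎 × x ≢ i × y ≢ i) → x ≡ i ⊎ y ≡ i → ⊥
    clash (inj₁ p≡i)             _          = p≢i p≡i
    clash (inj₂ (_ , x≢i , _))   (inj₁ x≡i) = x≢i x≡i
    clash (inj₂ (_ , _   , y≢i)) (inj₂ y≡i) = y≢i y≡i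

  -- In the order generated by adding elements of P and removing elements of N, the cut is the least
  -- set that contains `p` and avoids `x` and `y`.
  from-cut : ∀ p x y b → b p ≡ 𝟏 → b x ≡ 𝟎 → b y ≡ 𝟎 → F (cut p x y) ≡ 𝟏 → F b ≡ 𝟏
  from-cut p x y b bp bx by = monotone (cut p x y) b lose gain
    where
    lose : ∀ i → cut p x y i ≡ 𝟏 → b i ≡ 𝟎 → pos i ≡ 𝟎
    lose i e bi with ∈-cut⁻ p x y i e
    ... | inj₁ refl        = contradiction bi (𝟏≢𝟎 bp)
    ... | inj₂ (i-neg , _) = i-neg
    gain : ∀ i → cut p x y i ≡ 𝟎 → b i ≡ 𝟏 → pos i ≡ 𝟏
    gain i e bi = ≢𝟎⇒≡𝟏 λ i-neg → 𝟏≢𝟎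
      (∈-cut p x y i (inj₂ (i-neg , (λ { refl → 𝟏≢𝟎 bi bx }) , (λ { refl → 𝟏≢𝟎 bi by })))) e

  -- Here `b` has no positive element except possibly `p`, and contains N apart from `x` and `y`, so
  -- it lies below the cut in the same order.
  to-cut : ∀ p x y b → pos p ≡ 𝟏 → (∀ i → b i ≡ 𝟏 → pos i ≡ 𝟏 → p ≡ i) →
           (∀ i → pos i ≡ 𝟎 → x ≢ i → y ≢ i → b i ≡ 𝟏) → F b ≡ 𝟏 → F (cut p x y) ≡ 𝟏
  to-cut p x y b p-pos upper lower = monotone b (cut p x y)
    (λ i bi e → ≢𝟏⇒≡𝟎 λ i-pos → 𝟏≢𝟎 (∈-cut p x y i (inj₁ (upper i bi i-pos))) e) gain
    where
    gain : ∀ i → b i ≡ 𝟎 → cut p x y i ≡ 𝟏 → pos i ≡ 𝟏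
    gain i bi e with ∈-cut⁻ p x y i e
    ... | inj₁ refl            = p-pos
    ... | inj₂ (i-neg , x≢i , y≢i) = contradiction bi (𝟏≢𝟎 (lower i i-neg x≢i y≢i))

  -- An instance of 2in4 with the last two sets complemented. On N a cut depends only on the removed
  -- pair, and on P only on the added element; either way the four entries split into two opposite
  -- pairs.
  exchange : ∀ k l x y x′ y′ → pos k ≡ 𝟏 → pos l ≡ 𝟏 →
             F (cut k x y) ≡ 𝟏 → F (cut l x′ y′) ≡ 𝟏 →
             F (cut k x′ y′) ≡ 𝟎 → F (cut l x y) ≡ 𝟎 → ⊥
  exchange k l x y x′ y′ k-pos l-pos e₁ e₂ e₃ e₄ =
    four-nae two e₁ e₂ (complement (cut k x′ y′) e₃) (complement (cut l x y) e₄)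
    where
    pos-single : ∀ {p} i → pos p ≡ 𝟏 → pos i ≡ 𝟎 → single p i ≡ 𝟎
    pos-single {p} i p-pos i-neg = single-≢ {i = p} {i} λ { refl → 𝟏≢𝟎 p-pos i-neg }
    two : ∀ i → 2in4 (cut k x y i ∷ cut l x′ y′ i ∷ not (cut k x′ y′ i) ∷ not (cut l x y i) ∷ [])
    two i with pos i in i-sign
    ... | 𝟎 rewrite pos-single {k} i k-pos i-sign | pos-single {l} i l-pos i-sign
      with not (single x i) ∧ not (single y i) | not (single x′ i) ∧ not (single y′ i)
    ...   | 𝟎 | 𝟎 = refl
    ...   | 𝟎 | 𝟏 = refl
    ...   | 𝟏 | 𝟎 = refl
    ...   | 𝟏 | 𝟏 = refl
    two i | 𝟏 with single k i | single l i
    ...   | 𝟎 | 𝟎 = refl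
    ...   | 𝟎 | 𝟏 = refl
    ...   | 𝟏 | 𝟎 = refl
    ...   | 𝟏 | 𝟏 = refl

  -- By exchange the sets of cuts in the family form a chain, indexed by the positive p.
  exists-strongest : ∀ p₀ → pos p₀ ≡ 𝟏 → ∃[ p ] pos p ≡ 𝟏 ×
    (∀ k → pos k ≡ 𝟏 → ∀ x y → F (cut k x y) ≡ 𝟏 → F (cut p x y) ≡ 𝟏)
  exists-strongest p₀ p₀-pos =
    let p , p-pos , beats = go (allFin n) in p , p-pos , λ k → beats k (∈-allFin k)
    where
    Beats : Fin n → Fin n → Set
    Beats p k = pos k ≡ 𝟏 → ∀ x y → F (cut k x y) ≡ 𝟏 → F (cut p x y) ≡ 𝟏
    go : ∀ ks → ∃[ p ] pos p ≡ 𝟏 × (∀ k → k List.∈ ks → Beats p k)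
    go [] = p₀ , p₀-pos , λ _ ()
    go (k ∷ ks) with go ks
    ... | p , p-pos , beats
      with any? (λ x → any? (λ y → F (cut k x y) ≟ᵇ 𝟏 ×-dec F (cut p x y) ≟ᵇ 𝟎)) | pos k ≟ᵇ 𝟏
    ...   | _ | no k-neg = p , p-pos , λ where
      _ (here refl) k-pos → contradiction k-pos k-neg
      l (there l∈)        → beats l l∈
    ...   | no none | yes _ = p , p-pos , λ where
      _ (here refl) _ x y e → ≢𝟎⇒≡𝟏 λ e′ → none (x , y , e , e′)
      l (there l∈)          → beats l l∈
    -- `k` has a cut in the family where `p` has none, so by `exchange` every cut that works for `p`
    -- works for `k`, and `k` replaces `p`.
    ...   | yes (x , y , kxy , pxy) | yes k-pos = k , k-pos , λ where
      _ (here refl) _ _ _ e         → e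
      l (there l∈) l-pos x′ y′ e    → ≢𝟎⇒≡𝟏 λ e′ →
        exchange k p x y x′ y′ k-pos p-pos kxy (beats l l∈ l-pos x′ y′ e) e′ pxy

  private
    Pos Neg : Fin n → Set
    Pos i = pos i ≡ 𝟏
    Neg i = pos i ≡ 𝟎

    pos≢neg : ∀ i j → Pos i → Neg j → i ≢ j
    pos≢neg _ _ i-pos j-neg refl = 𝟏≢𝟎 i-pos j-neg

  -- All six rows lie in the family. The rows with `X` are `l` together with one of `x`, `y`, `z`;
  -- the rows with `Y` contain `p` and avoid two of `x`, `y`, `z`.
  two-pos : ∀ {p l x y z} → Pos p → Pos l → Neg x → Neg y → Neg z →
    p ≢ l → x ≢ y → x ≢ z → y ≢ z → (∀ i → Pos i → p ≡ i ⊎ l ≡ i) →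
    (∀ q → Neg q → F (cut p q q) ≡ 𝟎) →
    (∀ u v → Neg u → Neg v → u ≢ v → F (cut p u v) ≡ 𝟏) → ⊥
  two-pos {p} {l} {x} {y} {z} p-pos l-pos x-neg y-neg z-neg p≢l x≢y x≢z y≢z only
    single-cut double-cut = six-nae c 𝟏 rows
    where
    c : Fin n → Column
    c i = if single l i then X else if single x i then C₁ else if single y i then C₂
          else if single z i then C₃ else Y
    c-l : c l ≡ X
    c-l rewrite single-refl l = refl
    c-x : c x ≡ C₁
    c-x rewrite single-≢ (pos≢neg l x l-pos x-neg) | single-refl x = refl
    c-y : c y ≡ C₂
    c-y rewrite single-≢ (pos≢neg l y l-pos y-neg) | single-≢ x≢y | single-refl y = refl
    c-z : c z ≡ C₃
    c-z rewrite single-≢ (pos≢neg l z l-pos z-neg) | single-≢ x≢z | single-≢ y≢z | single-refl z = refl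
    c-p : c p ≡ Y
    c-p rewrite single-≢ (p≢l ∘ sym) | single-≢ (pos≢neg p x p-pos x-neg ∘ sym)
      | single-≢ (pos≢neg p y p-pos y-neg ∘ sym) | single-≢ (pos≢neg p z p-pos z-neg ∘ sym) = refl
    at : ∀ r {i t} → c i ≡ t → lookup (column (c i)) r ≡ lookup (column t) r
    at r = cong (λ t → lookup (column t) r)
    -- As `p` and `l` are the only positives, the complement of `cut p q q` consists of `l` and `q`.
    with-l : ∀ q b → Neg q → b l ≡ 𝟏 → (∀ i → l ≢ i → q ≢ i → b i ≡ 𝟎) → F b ≡ 𝟏
    with-l q b q-neg bl rest =
      monotone (not ∘ cut p q q) b lose gain (complement (cut p q q) (single-cut q q-neg))
      where
      lose : ∀ i → not (cut p q q i) ≡ 𝟏 → b i ≡ 𝟎 → Neg i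
      lose i e bi = ≢𝟏⇒≡𝟎 λ i-pos → clash (only i i-pos)
        where
        clash : p ≡ i ⊎ l ≡ i → ⊥
        clash (inj₁ p≡i)  = 𝟏≢𝟎 (∈-cut p q q i (inj₁ p≡i)) (not-injective e)
        clash (inj₂ refl) = 𝟏≢𝟎 bl bi
      gain : ∀ i → not (cut p q q i) ≡ 𝟎 → b i ≡ 𝟏 → Pos i
      gain i e bi with ∈-cut⁻ p q q i (not-injective e)
      ... | inj₁ refl              = p-pos
      ... | inj₂ (i-neg , q≢i , _) =
        contradiction (rest i (pos≢neg l i l-pos i-neg) q≢i) (𝟏≢𝟎 bi)
    avoid-x : ∀ i → l ≢ i → x ≢ i → lookup (column (c i)) zero ≡ 𝟎
    avoid-x i l≢i x≢i rewrite single-≢ l≢i | single-≢ x≢i with single y i | single z i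
    ... | 𝟎 | 𝟎 = refl
    ... | 𝟎 | 𝟏 = refl
    ... | 𝟏 | _ = refl
    avoid-y : ∀ i → l ≢ i → y ≢ i → lookup (column (c i)) (suc (suc zero)) ≡ 𝟎
    avoid-y i l≢i y≢i rewrite single-≢ l≢i | single-≢ y≢i with single x i | single z i
    ... | 𝟎 | 𝟎 = refl
    ... | 𝟎 | 𝟏 = refl
    ... | 𝟏 | _ = refl
    avoid-z : ∀ i → l ≢ i → z ≢ i → lookup (column (c i)) (suc (suc (suc (suc zero)))) ≡ 𝟎
    avoid-z i l≢i z≢i rewrite single-≢ l≢i | single-≢ z≢i with single x i | single y i
    ... | 𝟎 | 𝟎 = refl
    ... | 𝟎 | 𝟏 = refl
    ... | 𝟏 | _ = refl
    rows : ∀ r → F (λ i → lookup (column (c i)) r) ≡ 𝟏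
    rows r@zero                   = with-l x _ x-neg (at r c-l) avoid-x
    rows r@(suc (suc zero))       = with-l y _ y-neg (at r c-l) avoid-y
    rows r@(suc (suc (suc (suc zero)))) = with-l z _ z-neg (at r c-l) avoid-z
    rows r@(suc zero)             =
      from-cut p y z _ (at r c-p) (at r c-y) (at r c-z) (double-cut y z y-neg z-neg y≢z)
    rows r@(suc (suc (suc zero))) =
      from-cut p x z _ (at r c-p) (at r c-x) (at r c-z) (double-cut x z x-neg z-neg x≢z)
    rows r@(suc (suc (suc (suc (suc zero))))) =
      from-cut p x y _ (at r c-p) (at r c-x) (at r c-y) (double-cut x y x-neg y-neg x≢y)

  -- A set with `p` and without `q` lies above the cut; the opposite case follows by complementing.
  cut⇒fixes : ∀ p q → Pos p → Neg q → F (cut p q q) ≡ 𝟏 → Fixes F p q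
  cut⇒fixes p q p-pos q-neg e =
    pos≢neg p q p-pos q-neg ,
    (λ a ap aq → ≢𝟏⇒≡𝟎 λ ea → 𝟏≢𝟎
      (from-cut p q q (not ∘ a) (cong not ap) (cong not aq) (cong not aq) e) (complement a ea)) ,
    (λ a ap aq → from-cut p q q a ap aq aq e)

  fixes⇒cut : ∀ p q → Fixes F p q → Pos p × Neg q × F (cut p q q) ≡ 𝟏
  fixes⇒cut p q (p≢q , to𝟎 , to𝟏) =
    to𝟏 (single p) (single-refl p) (single-≢ p≢q) ,
    to𝟎 (single q) (single-≢ (p≢q ∘ sym)) (single-refl q) ,
    to𝟏 (cut p q q) (∈-cut p q q p (inj₁ refl)) (∉-cut p q q q p≢q (inj₁ refl))

  -- Decidability makes the later argument by contradiction constructive.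
  fixes? : Dec (∃[ i ] ∃[ j ] Fixes F i j)
  fixes? = map′
    (λ (p , q , p-pos , q-neg , e) → p , q , cut⇒fixes p q p-pos q-neg e)
    (λ (p , q , fixes) → p , q , fixes⇒cut p q fixes)
    (any? λ p → any? λ q →
      pos p ≟ᵇ 𝟏 ×-dec pos q ≟ᵇ 𝟎 ×-dec F (cut p q q) ≟ᵇ 𝟏)

  -- Families without a fixing pair

  module Unfixed (unfixed : ∀ i j → ¬ Fixes F i j) where

    single-cut : ∀ p q → Pos p → Neg q → F (cut p q q) ≡ 𝟎
    single-cut p q p-pos q-neg = ≢𝟏⇒≡𝟎 (unfixed p q ∘ cut⇒fixes p q p-pos q-neg)

    -- If `p` were the only positive, `cut p q q` would be the complement of the singleton of `q`,
    -- which is in the family.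
    another-pos : ∀ p q → Pos p → Neg q → ∃[ l ] Pos l × p ≢ l
    another-pos p q p-pos q-neg with any? (λ l → pos l ≟ᵇ 𝟏 ×-dec ¬? (p ≟ l))
    ... | yes found = found
    ... | no none   = contradiction (single-cut p q p-pos q-neg) (𝟏≢𝟎
      (to-cut p q q (not ∘ single q) p-pos
      (λ i _ i-pos → only i i-pos)
      (λ i _ q≢i _ → cong not (single-≢ {i = q} {i} q≢i))
      (complement (single q) q-neg)))
      where
      only : ∀ i → Pos i → p ≡ i
      only i i-pos with p ≟ i
      ... | yes p≡i = p≡i
      ... | no p≢i  = ⊥-elim (none (i , i-pos , p≢i))

    -- If `q` were the only negative, `cut p q q` would be the singleton of `p`.
    another-neg : ∀ p q → Pos p → Neg q → ∃[ l ] Neg l × q ≢ l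
    another-neg p q p-pos q-neg with any? (λ l → pos l ≟ᵇ 𝟎 ×-dec ¬? (q ≟ l))
    ... | yes found = found
    ... | no none   = contradiction (single-cut p q p-pos q-neg) (𝟏≢𝟎
      (to-cut p q q (single p) p-pos
      (λ i e _ → single-≡ p i e)
      (λ i i-neg q≢i _ → ⊥-elim (none (i , i-neg , q≢i)))
      p-pos))

    -- In this case `cut k x x` and `cut l y y` are complementary, yet both lie outside the family.
    two-pos-two-neg : ∀ {k l x y} → Pos k → Pos l → Neg x → Neg y →
      (∀ i → Pos i → k ≡ i ⊎ l ≡ i) → (∀ i → Neg i → x ≡ i ⊎ y ≡ i) → ⊥
    two-pos-two-neg {k} {l} {x} {y} k-pos l-pos x-neg y-neg only-pos only-neg =
      𝟏≢𝟎 (to-cut l y y (not ∘ cut k x x) l-pos upper lower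
             (complement (cut k x x) (single-cut k x k-pos x-neg)))
          (single-cut l y l-pos y-neg)
      where
      upper : ∀ i → not (cut k x x i) ≡ 𝟏 → Pos i → l ≡ i
      upper i e i-pos with only-pos i i-pos
      ... | inj₂ l≡i = l≡i
      ... | inj₁ k≡i = contradiction (not-injective e) (𝟏≢𝟎 (∈-cut k x x i (inj₁ k≡i)))
      lower : ∀ i → Neg i → y ≢ i → y ≢ i → not (cut k x x i) ≡ 𝟏
      lower i i-neg y≢i _ with only-neg i i-neg
      ... | inj₁ x≡i = cong not (∉-cut k x x i (pos≢neg k i k-pos i-neg) (inj₁ x≡i))
      ... | inj₂ y≡i = contradiction y≡i y≢i

    module _ (merged : ∀ {x y z} → x ≢ y → z ≢ x → z ≢ y → ∃[ i ] ∃[ j ] FixesWhenMerged F x y i j) where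

      double-cut : ∀ {p₀} x y → Pos p₀ → Neg x → Neg y → x ≢ y → ∃[ p ] Pos p × F (cut p x y) ≡ 𝟏
      double-cut {p₀} x y p₀-pos x-neg y-neg x≢y
        with merged x≢y (pos≢neg p₀ x p₀-pos x-neg) (pos≢neg p₀ y p₀-pos y-neg)
      ... | i , j , i≢j , i≢y , j≢y , to𝟎 , to𝟏 = i , i-pos , cut-i
        where
        i-pos : Pos i
        i-pos with x ≟ i
        ... | no x≢i = to𝟏 (single i)
          (trans (single-≢ {i = i} {x} (x≢i ∘ sym)) (sym (single-≢ i≢y)))
          (single-refl i) (single-≢ i≢j)
        -- If `i` is `x`, the pair puts the set of `x` and `y` in the family, but it is a disjoint
        -- union of two singletons outside it.
        ... | yes refl = contradiction
          (union (single x) (single y)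
            (λ k e → single-≢ λ y≡k → x≢y (trans (single-≡ x k e) (sym y≡k))) x-neg y-neg)
          (𝟏≢𝟎 (to𝟏 (λ k → single x k ∨ single y k)
            (trans in-x (sym in-y))
            in-x
            (cong₂ _∨_ (single-≢ i≢j) (single-≢ (j≢y ∘ sym)))))
          where
          in-x : single x x ∨ single y x ≡ 𝟏
          in-x rewrite single-refl x = refl
          in-y : single x y ∨ single y y ≡ 𝟏
          in-y rewrite single-≢ x≢y | single-refl y = refl
        cut-i : F (cut i x y) ≡ 𝟏
        cut-i with x ≟ j
        ... | yes refl = to𝟏 (cut i x y)
          (trans (∉-cut i x y x i≢j (inj₁ refl)) (sym (∉-cut i x y y i≢y (inj₂ refl))))
          (∈-cut i x y i (inj₁ refl)) (∉-cut i x y x i≢j (inj₁ refl))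
        -- If `j` is not `x`, then `j` is negative and `cut i j j` contains both `x` and `y`, so the
        -- merged pair puts it in the family, against `single-cut`.
        ... | no x≢j = contradiction (single-cut i j i-pos j-neg) (𝟏≢𝟎 (to𝟏 (cut i j j)
          (trans (∈-cut i j j x (inj₂ (x-neg , x≢j ∘ sym , x≢j ∘ sym)))
                 (sym (∈-cut i j j y (inj₂ (y-neg , j≢y , j≢y)))))
          (∈-cut i j j i (inj₁ refl))
          (∉-cut i j j j i≢j (inj₁ refl))))
          where
          j-neg : Neg j
          j-neg = to𝟎 (single j)
            (trans (single-≢ {i = j} {x} (x≢j ∘ sym)) (sym (single-≢ j≢y)))
            (single-≢ (i≢j ∘ sym)) (single-refl j)

      uniform-cut : ∀ p₀ → Pos p₀ → ∃[ p ] Pos p ×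
        (∀ x y → Neg x → Neg y → x ≢ y → F (cut p x y) ≡ 𝟏)
      uniform-cut p₀ p₀-pos =
        let p , p-pos , strongest = exists-strongest p₀ p₀-pos
        in p , p-pos , λ x y x-neg y-neg x≢y →
             let k , k-pos , e = double-cut {p₀} x y p₀-pos x-neg y-neg x≢y in strongest k k-pos x y e

      two-pos-three-neg : ∀ {k l x y z} → Pos k → Pos l → k ≢ l → Neg x → Neg y → Neg z →
        x ≢ y → x ≢ z → y ≢ z → (∀ i → Pos i → k ≡ i ⊎ l ≡ i) → ⊥
      two-pos-three-neg {k} {l} k-pos l-pos k≢l x-neg y-neg z-neg x≢y x≢z y≢z only
        with uniform-cut k k-pos
      ... | p , p-pos , cuts with only p p-pos
      ...   | inj₁ refl = two-pos k-pos l-pos x-neg y-neg z-neg k≢l x≢y x≢z y≢z only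
                            (λ q → single-cut k q k-pos) cuts
      ...   | inj₂ refl = two-pos l-pos k-pos x-neg y-neg z-neg (k≢l ∘ sym) x≢y x≢z y≢z
                            (λ i → swap ∘ only i) (λ q → single-cut l q l-pos) cuts

-- Contradiction according to the sizes of P and N

two-others : {Q : Fin n → Set} → ∀ {a b c} → Q a → Q b → Q c → a ≢ b → a ≢ c → b ≢ c → ∀ i →
  ∃[ u ] ∃[ v ] Q u × Q v × u ≢ v × u ≢ i × v ≢ i
two-others {a = a} {b} {c} qa qb qc a≢b a≢c b≢c i with i ≟ a | i ≟ b
... | yes refl | _        = b , c , qb , qc , b≢c , a≢b ∘ sym , a≢c ∘ sym
... | no _     | yes refl = a , c , qa , qc , a≢c , a≢b , b≢c ∘ sym
... | no i≢a   | no i≢b   = a , b , qa , qb , a≢b , i≢a ∘ sym , i≢b ∘ sym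

third? : {Q : Fin n → Set} → (∀ i → Dec (Q i)) → ∀ k l →
  (∃[ i ] Q i × k ≢ i × l ≢ i) ⊎ (∀ i → Q i → k ≡ i ⊎ l ≡ i)
third? Q? k l with any? (λ i → Q? i ×-dec ¬? (k ≟ i) ×-dec ¬? (l ≟ i))
... | yes found = inj₁ found
... | no none   = inj₂ case
  where
  case : ∀ i → _ → k ≡ i ⊎ l ≡ i
  case i q with k ≟ i | l ≟ i
  ... | yes k≡i | _       = inj₁ k≡i
  ... | no _    | yes l≡i = inj₂ l≡i
  ... | no k≢i  | no l≢i  = ⊥-elim (none (i , q , k≢i , l≢i))

unfixed-impossible : {F : Family n} → Compatible F → (∀ i → ∃[ j ] i ≢ j) → Fin n →
  (∀ i j → ¬ Fixes F i j) →
  ¬ (∀ {x y z} → x ≢ y → z ≢ x → z ≢ y → ∃[ i ] ∃[ j ] FixesWhenMerged F x y i j)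
unfixed-impossible {n} {F} F-compatible other i₀ unfixed merged =
  let p , p-pos       = exists-pos F-compatible other i₀
      q , q-pos′      = exists-pos F-compatible′ other i₀
      q-neg           = not-injective q-pos′
      p₂ , p₂-pos , p≢p₂ = U.another-pos p q p-pos q-neg
      q₂ , q₂-neg , q≢q₂ = U.another-neg p q p-pos q-neg
  in cases p-pos p₂-pos p≢p₂ q-neg q₂-neg q≢q₂
  where
  G : Family n
  G = not ∘ F
  F-compatible′ : Compatible G
  F-compatible′ = compatible-not F-compatible
  merged′ : ∀ {x y z} → x ≢ y → z ≢ x → z ≢ y → ∃[ i ] ∃[ j ] FixesWhenMerged G x y i j
  merged′ x≢y z≢x z≢y = let i , j , h = merged x≢y z≢x z≢y in j , i , fixesWhenMerged-not {F = F} h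
  module U  = Unfixed F-compatible unfixed
  module U′ = Unfixed F-compatible′ (λ i j h → unfixed j i (fixes-not {F = F} h))

  Pos Neg : Fin n → Set
  Pos i = F (single i) ≡ 𝟏
  Neg i = F (single i) ≡ 𝟎

  three-three : ∀ {p p₂ p₃ q q₂ q₃} → Pos p → Pos p₂ → Pos p₃ → p ≢ p₂ → p ≢ p₃ → p₂ ≢ p₃ →
    Neg q → Neg q₂ → Neg q₃ → q ≢ q₂ → q ≢ q₃ → q₂ ≢ q₃ → ⊥
  three-three {p} {q = q} p-pos p₂-pos p₃-pos p≢p₂ p≢p₃ p₂≢p₃ q-neg q₂-neg q₃-neg q≢q₂ q≢q₃ q₂≢q₃
    with U.uniform-cut merged p p-pos
  ... | s , s-pos , cuts
    with two-others {Q = Pos} p-pos p₂-pos p₃-pos p≢p₂ p≢p₃ p₂≢p₃ s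
  ... | u , v , u-pos , v-pos , u≢v , u≢s , v≢s
    with U′.double-cut merged′ {q} u v (cong not q-neg) (cong not u-pos) (cong not v-pos) u≢v
  ... | t , t-pos′ , co-cut
    with two-others {Q = Neg} q-neg q₂-neg q₃-neg q≢q₂ q≢q₃ q₂≢q₃ t
  ... | x , y , x-neg , y-neg , x≢y , x≢t , y≢t =
    -- The dual cut `b` consists of `t` and P without `u` and `v`. It contains `s` and avoids `x`
    -- and `y`, so it is in `F`, while `co-cut` puts it in the complementary family.
    𝟏≢𝟎 (from-cut F-compatible s x y b
           (∈-cut F-compatible′ t u v s (inj₂ (cong not s-pos , u≢s , v≢s)))
           (avoids x x-neg x≢t) (avoids y y-neg y≢t) (cuts x y x-neg y-neg x≢y))
        (not-injective co-cut)
    where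
    b : Fin n → Bool
    b = cut F-compatible′ t u v
    avoids : ∀ i → Neg i → i ≢ t → b i ≡ 𝟎
    avoids i i-neg i≢t = ≢𝟏⇒≡𝟎 λ e → clash (∈-cut⁻ F-compatible′ t u v i e)
      where
      clash : t ≡ i ⊎ (not (F (single i)) ≡ 𝟎 × u ≢ i × v ≢ i) → ⊥
      clash (inj₁ t≡i)         = i≢t (sym t≡i)
      clash (inj₂ (i-neg′ , _)) = 𝟏≢𝟎 (not-injective i-neg′) i-neg

  cases : ∀ {p p₂ q q₂} → Pos p → Pos p₂ → p ≢ p₂ → Neg q → Neg q₂ → q ≢ q₂ → ⊥
  cases {p} {p₂} {q} {q₂} p-pos p₂-pos p≢p₂ q-neg q₂-neg q≢q₂
    with third? {Q = Pos} (λ i → F (single i) ≟ᵇ 𝟏) p p₂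
       | third? {Q = Neg} (λ i → F (single i) ≟ᵇ 𝟎) q q₂
  ... | inj₂ only-pos | inj₂ only-neg = U.two-pos-two-neg p-pos p₂-pos q-neg q₂-neg only-pos only-neg
  ... | inj₂ only-pos | inj₁ (q₃ , q₃-neg , q≢q₃ , q₂≢q₃) =
    U.two-pos-three-neg merged p-pos p₂-pos p≢p₂ q-neg q₂-neg q₃-neg q≢q₂ q≢q₃ q₂≢q₃ only-pos
  ... | inj₁ (p₃ , p₃-pos , p≢p₃ , p₂≢p₃) | inj₂ only-neg =
    U′.two-pos-three-neg merged′ (cong not q-neg) (cong not q₂-neg) q≢q₂
      (cong not p-pos) (cong not p₂-pos) (cong not p₃-pos) p≢p₂ p≢p₃ p₂≢p₃
      (λ i e → only-neg i (not-injective e))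
  ... | inj₁ (p₃ , p₃-pos , p≢p₃ , p₂≢p₃) | inj₁ (q₃ , q₃-neg , q≢q₃ , q₂≢q₃) =
    three-three p-pos p₂-pos p₃-pos p≢p₂ p≢p₃ p₂≢p₃ q-neg q₂-neg q₃-neg q≢q₂ q≢q₃ q₂≢q₃

-- Identification of two coordinates and induction on the arity

merge : ∀ {m} {i j : Fin (suc m)} → i ≢ j → Fin (suc m) → Fin m
merge {j = j} i≢j k with j ≟ k
... | yes _  = punchOut (i≢j ∘ sym)
... | no j≢k = punchOut j≢k

-- A tuple with equal entries at `i` and `j` is recovered from its restriction to the coordinates
-- other than `j`.
punchIn-merge : ∀ {m} {A : Set} {i j : Fin (suc m)} (i≢j : i ≢ j) (a : Fin (suc m) → A) →
  a i ≡ a j → ∀ k → a (punchIn j (merge i≢j k)) ≡ a k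
punchIn-merge {j = j} i≢j a e k with j ≟ k
... | yes refl = trans (cong a (punchIn-punchOut (i≢j ∘ sym))) e
... | no j≢k   = cong a (punchIn-punchOut j≢k)

compatible-minor : ∀ {m} {F : Family n} → Compatible F → (π : Fin n → Fin m) →
  Compatible (λ b → F (b ∘ π))
compatible-minor F-compatible π = record
  { ext      = λ e → ext (e ∘ π)
  ; six-nae  = λ c → six-nae (c ∘ π)
  ; four-nae = λ two → four-nae (two ∘ π)
  }
  where open Compatible F-compatible

fixes-merge : ∀ {m} {F : Family (suc m)} → Compatible F → ∀ {x y i j} (x≢y : x ≢ y) →
  Fixes (λ b → F (b ∘ merge x≢y)) i j → FixesWhenMerged F x y (punchIn y i) (punchIn y j)
fixes-merge {F = F} F-compatible {x} {y} {i} {j} x≢y (i≢j , to𝟎 , to𝟏) =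
  i≢j ∘ punchIn-injective y i j , punchInᵢ≢i y i , punchInᵢ≢i y j ,
  (λ a e p q → trans (restrict a e) (to𝟎 (a ∘ punchIn y) p q)) ,
  (λ a e p q → trans (restrict a e) (to𝟏 (a ∘ punchIn y) p q))
  where
  open Compatible F-compatible
  restrict : ∀ a → a x ≡ a y → F a ≡ F (a ∘ punchIn y ∘ merge x≢y)
  restrict a e = ext (sym ∘ punchIn-merge x≢y a e)

-- Induction on the arity through the minors that identify two coordinates. At arity two, no third
-- coordinate `z` exists, so `merged` holds vacuously.
exists-fixes : ∀ m {F : Family (suc (suc m))} → Compatible F → ∃[ i ] ∃[ j ] Fixes F i j
exists-fixes m {F} F-compatible = decidable-stable (fixes? F-compatible) λ none →
  unfixed-impossible F-compatible other zero (λ i j h → none (i , j , h)) (merged m F-compatible)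
  where
  other : ∀ {m} (i : Fin (suc (suc m))) → ∃[ j ] i ≢ j
  other zero    = suc zero , λ ()
  other (suc _) = zero , λ ()
  merged : ∀ m {F : Family (suc (suc m))} → Compatible F → ∀ {x y z} →
    x ≢ y → z ≢ x → z ≢ y → ∃[ i ] ∃[ j ] FixesWhenMerged F x y i j
  merged zero _ {zero}     {zero}               x≢y _   _   = contradiction refl x≢y
  merged zero _ {suc zero} {suc zero}           x≢y _   _   = contradiction refl x≢y
  merged zero _ {zero}     {suc zero} {zero}    _   z≢x _   = contradiction refl z≢x
  merged zero _ {zero}     {suc zero} {suc zero} _  _   z≢y = contradiction refl z≢y
  merged zero _ {suc zero} {zero}     {zero}    _   _   z≢y = contradiction refl z≢y
  merged zero _ {suc zero} {zero}     {suc zero} _  z≢x _   = contradiction refl z≢x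
  merged (suc m) F-compatible {x} {y} x≢y _ _ =
    let i , j , fixes = exists-fixes m (compatible-minor F-compatible (merge x≢y))
    in punchIn y i , punchIn y j , fixes-merge F-compatible x≢y fixes

-- Finite checks on the relations of the left structure

Separated : ∀ {k} → Vec Bool k → Vec Bool k → Set
Separated u v = (∃[ r ] lookup u r ≡ 𝟏 × lookup v r ≡ 𝟎) × (∃[ r ] lookup u r ≡ 𝟎 × lookup v r ≡ 𝟏)

separated? : ∀ {k} (u v : Vec Bool k) → Dec (Separated u v)
separated? u v = any? (λ r → lookup u r ≟ᵇ 𝟏 ×-dec lookup v r ≟ᵇ 𝟎) ×-dec
                 any? (λ r → lookup u r ≟ᵇ 𝟎 ×-dec lookup v r ≟ᵇ 𝟏)

all-vec? : ∀ k {P : Vec Bool k → Set} → (∀ v → Dec (P v)) → Dec (∀ v → P v)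
all-vec? zero P? = map′ (λ { p [] → p }) (λ p → p []) (P? [])
all-vec? (suc k) P? = map′ (λ { (p , q) (𝟎 ∷ v) → p v ; (p , q) (𝟏 ∷ v) → q v })
  (λ p → (λ v → p (𝟎 ∷ v)) , (λ v → p (𝟏 ∷ v)))
  (all-vec? k (λ v → P? (𝟎 ∷ v)) ×-dec all-vec? k (λ v → P? (𝟏 ∷ v)))

stl? : ∀ s u → Dec (rel STL s u)
stl? six  u = u ∈? _
stl? four u = count (_≟ᵇ 𝟏) u ≟ⁿ 2

antichain : ∀ s u → rel STL s u → ∀ v → rel STL s v → u ≡ v ⊎ Separated u v
antichain = λ { six → from-yes (decide six) ; four → from-yes (decide four) }
  where
  decide : ∀ s → Dec (∀ u → rel STL s u → ∀ v → rel STL s v → u ≡ v ⊎ Separated u v)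
  decide s = all-vec? _ λ u → stl? s u →-dec all-vec? _ λ v → stl? s v →-dec
    (≡-dec _≟ᵇ_ u v ⊎-dec separated? u v)

NonConstant : ∀ {k} → Vec Bool k → Set
NonConstant u = (∃[ r ] lookup u r ≡ 𝟏) × (∃[ r ] lookup u r ≡ 𝟎)

nonConstant : ∀ s u → rel STL s u → NonConstant u
nonConstant = λ { six → from-yes (decide six) ; four → from-yes (decide four) }
  where
  decide : ∀ s → Dec (∀ u → rel STL s u → NonConstant u)
  decide s = all-vec? _ λ u → stl? s u →-dec
    (any? (λ r → lookup u r ≟ᵇ 𝟏) ×-dec any? (λ r → lookup u r ≟ᵇ 𝟎))

-- Minors and polymorphisms

minor-trans : ∀ {A B : Set} {l m n} {h : Op A B l} {g : Op A B m} {f : Op A B n} →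
  h MinorOf g → g MinorOf f → h MinorOf f
minor-trans {f = f} (π , h≗) (ρ , g≗) = π ∘ ρ , λ a → trans (h≗ a)
  (trans (g≗ _) (cong f (tabulate-cong λ i → lookup∘tabulate _ (ρ i))))

minor-refl : ∀ {A B : Set} {f : Op A B n} → f MinorOf f
minor-refl {f = f} = id , λ a → cong f (sym (tabulate∘lookup a))

-- Column `i` of the matrix rearranged by `π` is column `π i` of the original, so all columns stay
-- in the relation.
pol-isMinion : ∀ {σ} (𝔸 𝔹 : Structure σ) → IsMinion (Pol 𝔸 𝔹)
pol-isMinion 𝔸 𝔹 {g = g} {f} (π , g≗) f-pol s t t-rel =
  subst (rel 𝔹 s) (trans (sym (map-∘ f ρ t)) (map-cong (sym ∘ g≗) t))
    (f-pol s (map ρ t) λ i → subst (rel 𝔸 s)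
      (sym (trans (sym (map-∘ _ ρ t)) (map-cong (λ v → lookup∘tabulate _ i) t)))
      (t-rel (π i)))
  where
  ρ = λ v → tabulate (lookup v ∘ π)

tabulate-const : ∀ {A : Set} (x : A) n → tabulate {n = n} (λ _ → x) ≡ replicate n x
tabulate-const x zero    = refl
tabulate-const x (suc n) = cong (x ∷_) (tabulate-const x n)

polConst⇒constant : ∀ {c} {f : BoolFun n} → f ∈ PolConst c n → f (replicate n c) ≡ c
polConst⇒constant {n} {c} f-pol =
  ∷-injectiveˡ (f-pol unary (replicate n c ∷ []) λ i → cong (_∷ []) (lookup-replicate i c))

constant⇒polConst : ∀ {c} {f : BoolFun n} → f (replicate n c) ≡ c → f ∈ PolConst c n
constant⇒polConst {n} {c} {f} e unary (v ∷ []) h = cong (_∷ []) (trans (cong f v≡) e)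
  where
  v≡ : v ≡ replicate n c
  v≡ = trans (sym (tabulate∘lookup v))
    (trans (tabulate-cong (λ i → ∷-injectiveˡ (h i))) (tabulate-const c n))

pol⇒compatible : {f : BoolFun n} → f ∈ Pol STL STR n → Compatible (f ∘ tabulate)
pol⇒compatible {n} {f} f-pol = record
  { ext      = cong f ∘ tabulate-cong
  ; six-nae  = λ c v e → nae six (λ r i → lookup (column (c i)) r)
      (λ i → subst R (sym (tabulate∘lookup (column (c i)))) (column∈R (c i))) v e
  ; four-nae = λ {a} {b} {c} {d} two {v} ea eb ec ed →
      nae four (lookup (a ∷ b ∷ c ∷ d ∷ [])) two v
        λ { zero → ea ; (suc zero) → eb ; (suc (suc zero)) → ec ; (suc (suc (suc zero))) → ed }
  }
  where
  column∈R : ∀ c → R (column c)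
  column∈R X  = here refl
  column∈R Y  = there (here refl)
  column∈R C₁ = there (there (here refl))
  column∈R C₂ = there (there (there (here refl)))
  column∈R C₃ = there (there (there (there (here refl))))
  constant-free : ∀ s t → rel STR s t → ∀ c → t ≢ replicate _ c
  constant-free six  _ h c e = h (c , e)
  constant-free four _ h c e = h (c , e)
  -- `M` is a matrix: its rows are arguments of `f`, its columns are tuples of the relation.
  nae : ∀ s (M : Fin (arity stSignature s) → Fin n → Bool) →
        (∀ i → rel STL s (tabulate λ r → M r i)) → ∀ v → ¬ (∀ r → f (tabulate (M r)) ≡ v)
  nae s M h v e = constant-free s _
    (f-pol s (tabulate (tabulate ∘ M)) λ i → subst (rel STL s)
      (trans (tabulate-cong λ r → sym (lookup∘tabulate (M r) i)) (tabulate-∘ _ _)) (h i))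
    v
    (trans (sym (tabulate-∘ f _)) (trans (tabulate-cong e) (tabulate-const v _)))

pol⇒fixingPair : ∀ {m} → 2 ≤ m → {f : BoolFun m} → f ∈ Pol STL STR m → HasFixingPair f
pol⇒fixingPair {suc (suc m)} (s≤s (s≤s _)) {f} f-pol =
  let i , j , i≢j , to𝟎 , to𝟏 = exists-fixes m (pol⇒compatible f-pol)
  in i , j , i≢j , (λ a p q → trans (cong f (sym (tabulate∘lookup a))) (to𝟎 (lookup a) p q))
               , (λ a p q → trans (cong f (sym (tabulate∘lookup a))) (to𝟏 (lookup a) p q))

-- Generators read off from the heaviest differing pair

differ : Bool → Bool → Maybe Bool
differ 𝟎 𝟏 = just 𝟎
differ 𝟏 𝟎 = just 𝟏
differ _ _ = nothing

differ-refl : ∀ p → differ p p ≡ nothing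
differ-refl 𝟎 = refl
differ-refl 𝟏 = refl

-- The recursive call stands on the left of `<∣>`, so later pairs, which carry the larger weights,
-- take precedence.
lastDiffering : ∀ m → (Fin (m * 2) → Bool) → Maybe Bool
lastDiffering zero    a = nothing
lastDiffering (suc m) a =
  lastDiffering m (λ l → a (suc (suc l))) <∣> differ (a zero) (a (suc zero))

-- The exponents `h` are a parameter because dropping the first pair replaces `h` by `suc ∘ h` or
-- `h ∘ suc`; for `h = suc` this is the tail of `stWeights`.
pairWeights : (ℕ → ℕ) → ∀ m → Vec ℤ (m * 2)
pairWeights h m = concat (tabulate {n = m} λ i → + (2 ^ h (toℕ i)) ∷ ℤ.- (+ (2 ^ h (toℕ i))) ∷ [])

weightedSum-double : ∀ h m (v : Vec Bool (m * 2)) →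
  weightedSum (pairWeights (suc ∘ h) m) v ≡ + 2 ℤ.* weightedSum (pairWeights h m) v
weightedSum-double h zero    []          = refl
weightedSum-double h (suc m) (p ∷ q ∷ v) = trans
  (cong₂ (λ w s → w ℤ.* bit p ℤ.+ ((ℤ.- w) ℤ.* bit q ℤ.+ s))
    (ℤ.pos-* 2 (2 ^ h 0)) (weightedSum-double (h ∘ suc) m v))
  (distribute (+ (2 ^ h 0)) (bit p) (bit q) (weightedSum (pairWeights (h ∘ suc) m) v))
  where
  distribute : ∀ w p q s →
    (+ 2 ℤ.* w) ℤ.* p ℤ.+ ((ℤ.- (+ 2 ℤ.* w)) ℤ.* q ℤ.+ + 2 ℤ.* s) ≡
    + 2 ℤ.* (w ℤ.* p ℤ.+ ((ℤ.- w) ℤ.* q ℤ.+ s))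
  distribute = solve-∀

-- The margin 2, rather than a mere sign, survives the induction and exceeds the leading weight 1.
Decides : Maybe Bool → ℤ → Set
Decides nothing  s = s ≡ 0ℤ
Decides (just 𝟏) s = + 2 ℤ.≤ s
Decides (just 𝟎) s = s ℤ.≤ -[1+ 1 ]

lastDiffering-decides : ∀ m a →
  Decides (lastDiffering m a) (weightedSum (pairWeights suc m) (tabulate a))
lastDiffering-decides zero    a = refl
lastDiffering-decides (suc m) a
  rewrite weightedSum-double suc m (tabulate (λ l → a (suc (suc l))))
  with lastDiffering m (λ l → a (suc (suc l)))
     | weightedSum (pairWeights suc m) (tabulate (λ l → a (suc (suc l))))
     | lastDiffering-decides m (λ l → a (suc (suc l)))
     | a zero | a (suc zero)
... | nothing | _ | refl | 𝟎 | 𝟎 = refl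
... | nothing | _ | refl | 𝟎 | 𝟏 = -≤- (s≤s z≤n)
... | nothing | _ | refl | 𝟏 | 𝟎 = +≤+ (s≤s (s≤s z≤n))
... | nothing | _ | refl | 𝟏 | 𝟏 = refl
-- The doubled tail is at least 4, and the lightest pair takes away at most 2.
... | just 𝟏 | _ | 2≤s | p | q =
  ℤ.+-mono-≤ (positive p) (ℤ.+-mono-≤ (negative q) (ℤ.*-monoˡ-≤-nonNeg (+ 2) 2≤s))
  where
  positive : ∀ p → 0ℤ ℤ.≤ + 2 ℤ.* bit p
  positive 𝟎 = +≤+ z≤n
  positive 𝟏 = +≤+ z≤n
  negative : ∀ q → -[1+ 1 ] ℤ.≤ -[1+ 1 ] ℤ.* bit q
  negative 𝟎 = -≤+
  negative 𝟏 = -≤- ≤-refl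
... | just 𝟎 | _ | s≤-2 | p | q =
  ℤ.+-mono-≤ (positive p) (ℤ.+-mono-≤ (negative q) (ℤ.*-monoˡ-≤-nonNeg (+ 2) s≤-2))
  where
  positive : ∀ p → + 2 ℤ.* bit p ℤ.≤ + 2
  positive 𝟎 = +≤+ z≤n
  positive 𝟏 = +≤+ ≤-refl
  negative : ∀ q → -[1+ 1 ] ℤ.* bit q ℤ.≤ 0ℤ
  negative 𝟎 = +≤+ z≤n
  negative 𝟏 = -≤+

generator : ∀ m → BoolFun (suc (m * 2))
generator m = ⟨ stWeights m ∣≤ 0ℤ

-- If some pair differs, the weight 1 cannot overturn the margin 2; otherwise the pairs cancel and
-- the first coordinate alone decides.
generator-lastDiffering : ∀ m a →
  generator m (tabulate a) ≡ fromMaybe (a zero) (lastDiffering m (a ∘ suc))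
generator-lastDiffering m a
  with lastDiffering m (a ∘ suc)
     | weightedSum (pairWeights suc m) (tabulate (a ∘ suc))
     | lastDiffering-decides m (a ∘ suc)
... | nothing | _ | refl = unit (a zero)
  where
  unit : ∀ b → not (does (1ℤ ℤ.* bit b ℤ.+ 0ℤ ℤ.≤? 0ℤ)) ≡ b
  unit 𝟎 = refl
  unit 𝟏 = refl
... | just 𝟏 | s | 2≤s = cong not (dec-false (_ ℤ.≤? 0ℤ) λ ≤0 →
  contradiction (ℤ.≤-trans (ℤ.+-mono-≤ (low (a zero)) 2≤s) ≤0) λ { (+≤+ ()) })
  where
  low : ∀ b → 0ℤ ℤ.≤ 1ℤ ℤ.* bit b
  low 𝟎 = +≤+ z≤n
  low 𝟏 = +≤+ z≤n
... | just 𝟎 | s | s≤-2 = cong not (dec-true (_ ℤ.≤? 0ℤ)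
  (ℤ.≤-trans (ℤ.+-mono-≤ (high (a zero)) s≤-2) -≤+))
  where
  high : ∀ b → 1ℤ ℤ.* bit b ℤ.≤ 1ℤ
  high 𝟎 = +≤+ z≤n
  high 𝟏 = +≤+ ≤-refl

-- Generators as idempotent polymorphisms

lastDiffering-separates : ∀ s m (M : Fin (arity stSignature s) → Fin (m * 2) → Bool)
  (u : Fin (m * 2) → Vec Bool (arity stSignature s)) →
  (∀ i → rel STL s (u i)) → (∀ i r → lookup (u i) r ≡ M r i) →
  (∀ r → lastDiffering m (M r) ≡ nothing) ⊎
  ((∃[ r ] lastDiffering m (M r) ≡ just 𝟏) × (∃[ r ] lastDiffering m (M r) ≡ just 𝟎))
lastDiffering-separates s zero    M u u-rel entry = inj₁ λ _ → refl
lastDiffering-separates s (suc m) M u u-rel entry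
  with lastDiffering-separates s m (λ r l → M r (suc (suc l))) (λ l → u (suc (suc l)))
         (λ l → u-rel (suc (suc l))) (λ l → entry (suc (suc l)))
... | inj₂ ((r , e) , (r′ , e′)) = inj₂ ((r , cong (_<∣> differ (M r zero) (M r (suc zero))) e) ,
       (r′ , cong (_<∣> differ (M r′ zero) (M r′ (suc zero))) e′))
-- No later pair differs in any row, so the first pair decides: its columns are equal, or they
-- differ in both directions and yield both values.
... | inj₁ none
  with antichain s (u zero) (u-rel zero) (u (suc zero)) (u-rel (suc zero))
...   | inj₁ u₀≡u₁ = inj₁ λ r → cong₂ _<∣>_ (none r)
  (trans (cong (λ p → differ p (M r (suc zero)))
    (trans (sym (entry zero r)) (trans (cong (λ v → lookup v r) u₀≡u₁) (entry (suc zero) r))))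
    (differ-refl (M r (suc zero))))
...   | inj₂ ((r , p , q) , (r′ , p′ , q′)) =
  inj₂ ((r , at r p q) , (r′ , at r′ p′ q′))
  where
  at : ∀ r {p q} → lookup (u zero) r ≡ p → lookup (u (suc zero)) r ≡ q →
       lastDiffering (suc m) (M r) ≡ differ p q
  at r e e′ = cong₂ _<∣>_ (none r)
    (cong₂ differ (trans (sym (entry zero r)) e) (trans (sym (entry (suc zero) r)) e′))

generator∈pol : ∀ m → generator m ∈ Pol STL STR (suc (m * 2))
generator∈pol m s t t-rel = nae s takes-both
  where
  M : Fin (arity stSignature s) → Fin (suc (m * 2)) → Bool
  M r = lookup (lookup t r)
  columnOf : ∀ i → Vec Bool (arity stSignature s)
  columnOf i = map (λ v → lookup v i) t
  entry : ∀ i r → lookup (columnOf i) r ≡ M r i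
  entry i r = lookup-map r (λ v → lookup v i) t
  value : ∀ r → lookup (map (generator m) t) r ≡
                fromMaybe (M r zero) (lastDiffering m (M r ∘ suc))
  value r = trans (lookup-map r (generator m) t)
    (trans (cong (generator m) (sym (tabulate∘lookup (lookup t r))))
           (generator-lastDiffering m (M r)))
  takes-both : NonConstant (map (generator m) t)
  takes-both with lastDiffering-separates s m (λ r l → M r (suc l)) (λ l → columnOf (suc l))
                    (λ l → t-rel (suc l)) (λ l → entry (suc l))
  ... | inj₂ ((r , e) , (r′ , e′)) =
    (r  , trans (value r)  (cong (fromMaybe (M r zero)) e)) ,
    (r′ , trans (value r′) (cong (fromMaybe (M r′ zero)) e′))
  -- The rows then return the entries of the first column, which is not constant.
  ... | inj₁ none =
    let (r , e) , (r′ , e′) = nonConstant s (columnOf zero) (t-rel zero)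
    in (r  , trans (value r)  (trans (cong (fromMaybe (M r zero)) (none r))
                                   (trans (sym (entry zero r)) e))) ,
       (r′ , trans (value r′) (trans (cong (fromMaybe (M r′ zero)) (none r′))
                                   (trans (sym (entry zero r′)) e′)))
  nonConstant⇒NAE : ∀ {k} {u : Vec Bool k} → NonConstant u → NAE k u
  nonConstant⇒NAE ((r , e) , (r′ , e′)) (c , refl) = 𝟏≢𝟎
    (trans (sym (lookup-replicate r c)) e) (trans (sym (lookup-replicate r′ c)) e′)
  nae : ∀ s {u} → NonConstant u → rel STR s u
  nae six  = nonConstant⇒NAE
  nae four = nonConstant⇒NAE

generator-constant : ∀ m c → generator m (replicate _ c) ≡ c
generator-constant m c =
  trans (cong (generator m) (sym (tabulate-const c _)))
    (trans (generator-lastDiffering m (λ _ → c)) (cong (fromMaybe c) (none m)))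
  where
  none : ∀ m → lastDiffering m (λ _ → c) ≡ nothing
  none zero = refl
  none (suc m) = cong₂ _<∣>_ (none m) (differ-refl c)

ST⇒pol : ∀ {f : BoolFun n} → f ∈ ST n → f ∈ (Pol STL STR n ∩ PolConst 𝟎 n ∩ PolConst 𝟏 n)
ST⇒pol {n} = generated-least STGenerator (λ n → Pol STL STR n ∩ PolConst 𝟎 n ∩ PolConst 𝟏 n)
  (λ g⊑f (p , q , r) → pol-isMinion STL STR g⊑f p ,
    pol-isMinion (constStructure 𝟎) (constStructure 𝟎) g⊑f q ,
    pol-isMinion (constStructure 𝟏) (constStructure 𝟏) g⊑f r)
  (λ { _ (stGenerator m) → generator∈pol m ,
    constant⇒polConst (generator-constant m 𝟎) , constant⇒polConst (generator-constant m 𝟏) })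
  n

-- Peeling off fixing pairs

snoc₂ : ∀ {A : Set} k → (Fin (k * 2) → A) → A → A → Fin (suc k * 2) → A
snoc₂ zero    ps i j zero          = i
snoc₂ zero    ps i j (suc zero)    = j
snoc₂ (suc k) ps i j zero          = ps zero
snoc₂ (suc k) ps i j (suc zero)    = ps (suc zero)
snoc₂ (suc k) ps i j (suc (suc l)) = snoc₂ k (λ l → ps (suc (suc l))) i j l

-- The pair peeled off first must override all others, so it goes to the heavy end of the sequence.
lastDiffering-snoc₂ : ∀ {A : Set} k (g : A → Bool) ps i j →
  lastDiffering (suc k) (g ∘ snoc₂ k ps i j) ≡ differ (g i) (g j) <∣> lastDiffering k (g ∘ ps)
lastDiffering-snoc₂ zero    g ps i j = sym (<∣>-identityʳ _)
lastDiffering-snoc₂ (suc k) g ps i j =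
  trans (cong (_<∣> differ (g (ps zero)) (g (ps (suc zero))))
          (lastDiffering-snoc₂ k g (λ l → ps (suc (suc l))) i j))
    (<∣>-assoc (differ (g i) (g j)) _ _)

-- A fixing pair decides `f` where its entries differ. Where they agree, `f` equals the minor
-- identifying them, which inherits both hypotheses.
fixingPairs⇒lastDiffering : ∀ m (f : BoolFun (suc m)) → Idempotent f → NonUnaryMinorsHaveFixingPair f →
  ∃[ k ] ∃[ ps ] ∃[ x₀ ] ∀ a → f (tabulate a) ≡ fromMaybe (a x₀) (lastDiffering k (a ∘ ps))
-- At arity one, idempotence makes `f` the identity: no pairs, and the only coordinate as default.
fixingPairs⇒lastDiffering zero    f idem _ = 0 , (λ ()) , zero , λ a → idem (a zero)
fixingPairs⇒lastDiffering (suc m) f idem fixing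
  with fixing (s≤s (s≤s z≤n)) f (minor-refl {f = f})
... | i , j , i≢j , to𝟎 , to𝟏 =
  let k , ps , x₀ , represents = fixingPairs⇒lastDiffering m f′ idem′
        λ 2≤l g g⊑f′ → fixing 2≤l g (minor-trans {h = g} {f′} {f} g⊑f′ f′⊑f)
  in suc k , snoc₂ k (punchIn j ∘ ps) i j , punchIn j x₀ , λ a →
     trans (step a (lastDiffering k (a ∘ punchIn j ∘ ps)) (represents (a ∘ punchIn j)))
       (cong (fromMaybe (a (punchIn j x₀))) (sym (lastDiffering-snoc₂ k a (punchIn j ∘ ps) i j)))
  where
  π : Fin (suc (suc m)) → Fin (suc m)
  π = merge i≢j
  f′ : BoolFun (suc m)
  f′ b = f (tabulate (λ l → lookup b (π l)))
  f′⊑f : f′ MinorOf f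
  f′⊑f = π , λ _ → refl
  idem′ : Idempotent f′
  idem′ c = trans (cong f (trans (tabulate-cong λ l → lookup-replicate (π l) c) (tabulate-const c _)))
    (idem c)
  agree : ∀ a → a i ≡ a j → f (tabulate a) ≡ f′ (tabulate (a ∘ punchIn j))
  agree a e = cong f (tabulate-cong λ l →
    sym (trans (lookup∘tabulate (a ∘ punchIn j) (π l)) (punchIn-merge i≢j a e l)))
  step : ∀ a {x} v → f′ (tabulate (a ∘ punchIn j)) ≡ fromMaybe x v →
         f (tabulate a) ≡ fromMaybe x (differ (a i) (a j) <∣> v)
  step a v e with a i in ai | a j in aj
  ... | 𝟎 | 𝟏 = to𝟎 (tabulate a) (trans (lookup∘tabulate a i) ai) (trans (lookup∘tabulate a j) aj)
  ... | 𝟏 | 𝟎 = to𝟏 (tabulate a) (trans (lookup∘tabulate a i) ai) (trans (lookup∘tabulate a j) aj)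
  ... | 𝟎 | 𝟎 = trans (agree a (trans ai (sym aj))) e
  ... | 𝟏 | 𝟏 = trans (agree a (trans ai (sym aj))) e

fixingPairs⇒ST : ∀ {f : BoolFun n} → 1 ≤ n → Idempotent f → NonUnaryMinorsHaveFixingPair f → f ∈ ST n
fixingPairs⇒ST {suc m} {f} _ idem fixing
  with fixingPairs⇒lastDiffering m f idem fixing
... | k , ps , x₀ , represents = minor (π , agree) (base (stGenerator k))
  where
  -- The weight 1 goes to the default coordinate and the paired weights to the fixing pairs;
  -- coordinates may repeat.
  π : Fin (suc (k * 2)) → Fin (suc m)
  π zero    = x₀
  π (suc l) = ps l
  agree : ∀ a → f a ≡ generator k (tabulate (λ l → lookup a (π l)))
  agree a = trans (cong f (sym (tabulate∘lookup a)))
    (trans (represents (lookup a)) (sym (generator-lastDiffering k (lookup a ∘ π))))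

pol⇒fixingPairs : ∀ {f : BoolFun n} → f ∈ (Pol STL STR n ∩ PolConst 𝟎 n ∩ PolConst 𝟏 n) →
  Idempotent f × NonUnaryMinorsHaveFixingPair f
pol⇒fixingPairs (f-pol , f-pol𝟎 , f-pol𝟏) =
  (λ { 𝟎 → polConst⇒constant f-pol𝟎 ; 𝟏 → polConst⇒constant f-pol𝟏 }) ,
  λ 2≤m g g⊑f → pol⇒fixingPair 2≤m (pol-isMinion STL STR g⊑f f-pol)

theorem3p8 : (n : ℕ) → 1 ≤ n → (f : BoolFun n) →
    (f ∈ ST n ⇔ f ∈ (Pol STL STR n ∩ PolConst false n ∩ PolConst true n)) ×
    (f ∈ (Pol STL STR n ∩ PolConst false n ∩ PolConst true n) ⇔
    (Idempotent f × NonUnaryMinorsHaveFixingPair f))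
theorem3p8 n 1≤n f =
  mk⇔ ST⇒pol (λ h → let idem , fixing = pol⇒fixingPairs h in fixingPairs⇒ST 1≤n idem fixing) ,
  mk⇔ pol⇒fixingPairs (λ (idem , fixing) → ST⇒pol (fixingPairs⇒ST 1≤n idem fixing))
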